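{- $\Phi_4(3)=\dfrac{13}{24}$ and $\Phi_4(6)=\dfrac58$.
   Context: An infinite binary image is a map $I:\mathbb{Z}^2\to\{\text{black},\text{white}\}$. Two pixels $x,y$ are $4$-adjacent if $|x_1-y_1|+|x_2-y_2|=1$; a white $4$-connected component is a maximal set of white pixels connected under $4$-adjacency, and its size is its number of pixels. $\rho(I)=\liminf_{j\to\infty,\ j\text{ odd}}W_j/j^2$ with $W_j$ the number of white pixels in the $j\times j$ box centered at the origin. $\Phi_4(k)$ is the supremum of $\rho(I)$ over all infinite binary images all of whose white $4$-connected components have size at most $k$. -}

module Defs where

open import Data.Bool using (Bool; true; false; T)
open import Data.Nat using (ℕ; zero; suc; _+_; _*_; _≤_; _<_; _>_)
open import Data.Integer as ℤ using (ℤ; +_; ∣_∣)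
open import Data.Product using (_×_; _,_; Σ; ∃; ∃-syntax)
open import Data.List using (List; []; _∷_; map; length; filter; concatMap; upTo)
open import Data.List.Relation.Unary.All using (All)
open import Data.List.Relation.Unary.Unique.Propositional using (Unique)
open import Relation.Binary.PropositionalEquality using (_≡_)
open import Relation.Nullary.Decidable using (does)
open import Data.Bool.Properties using (T?)

Pixel : Set
Pixel = ℤ × ℤ

Image : Set
Image = Pixel → Bool

White : Image → Pixel → Set
White I p = T (I p)

Adj4 : Pixel → Pixel → Set
Adj4 (x₁ , x₂) (y₁ , y₂) = ∣ x₁ ℤ.- y₁ ∣ + ∣ x₂ ℤ.- y₂ ∣ ≡ 1

data WPath (I : Image) : Pixel → Pixel → Set where
  here : ∀ {p} → White I p → WPath I p p
  step : ∀ {p q r} → White I p → Adj4 p q → WPath I q r → WPath I p r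

ComponentsAtMost : ℕ → Image → Set
ComponentsAtMost k I =
  ∀ (p : Pixel) → White I p →
  ∀ (xs : List Pixel) → Unique xs → All (WPath I p) xs → length xs ≤ k

range : ℕ → List ℤ
range n = map (λ i → (+ i) ℤ.- (+ n)) (upTo (suc (n + n)))

box : ℕ → List Pixel
box n = concatMap (λ x → map (λ y → (x , y)) (range n)) (range n)

Wcount : Image → ℕ → ℕ
Wcount I n = length (filter (λ p → T? (I p)) (box n))

side : ℕ → ℕ
side n = suc (n + n)

-- ρ(I) ≤ a/b  (liminf over odd j): for every ε = 1/(m+1) and every N there is
-- an odd j = 2n+1 ≥ N with W_j / j² < a/b + ε, i.e.
-- W_j · b · (m+1) < (a·(m+1) + b) · j².
DensityLE : Image → ℕ → ℕ → Set
DensityLE I a b =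
  ∀ (m N : ℕ) → ∃[ n ] (N ≤ side n ×
     Wcount I n * b * suc m < (a * suc m + b) * (side n * side n))

-- ρ(I) ≥ a/b − 1/(m+1): eventually (for all odd j = 2n+1 ≥ N)
-- W_j / j² > a/b − 1/(m+1). This implies ρ(I) ≥ a/b − 1/(m+1) and is
-- implied by ρ(I) > a/b − 1/(m+1); quantified over all m it is exactly
-- "sup ρ ≥ a/b".
-- Written as: W_j · b · (m+1) + b · j² > a · (m+1) · j².
DensityGE-eps : Image → ℕ → ℕ → ℕ → Set
DensityGE-eps I a b m =
  ∃[ N ] ∀ (n : ℕ) → N ≤ side n →
     a * suc m * (side n * side n) < Wcount I n * b * suc m + b * (side n * side n)

Phi4Is : ℕ → ℕ → ℕ → Set
Phi4Is k a b =
  (∀ (I : Image) → ComponentsAtMost k I → DensityLE I a b) ×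
  (∀ (m : ℕ) → ∃[ I ] (ComponentsAtMost k I × DensityGE-eps I a b m))

-- Upper bounds by discharging, localizing 4B = (white-black edges) + 2 (black-black edges):
-- every black pixel hands a quarter of its charge through each of its four sides, to the white
-- neighbour if there is one, and otherwise to the white pixels flanking the black-black edge.
-- With c W ≤ h B as the goal
-- (c / h = 11 / 13 for k = 3 and 3 / 5 for k = 6), all components then receive what they need,
-- except, by a little, the L-tromino (k = 3) and the plus pentomino with one notch filled
-- (k = 6). Such a component has a convex "outer" corner whose diagonal neighbour q is not in
-- it. If q is black, or if a black-black edge at that corner has only one white flank, then the
-- component receives at least one additional half share of such an edge. Otherwise q is a white
-- pixel whose component has charge to spare, being a single pixel or containing a J-tetromino
-- with end q, and q pays the deficit across the diagonal. The finitely many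
-- shapes of a component of size at most k are checked by a verified search. Blackening
-- everything outside the box leaves only the charge of a frame of width 1 to be estimated.
--
-- Lower bounds by lattice tilings, white iff c x + y mod N lies in a fixed set: plus pentominoes
-- with index 8 for k = 6, and four L-trominoes around a single pixel with index 24 for k = 3.
module Submission where

open import Defs
open import Algebra.Bundles using (AbelianGroup)
import Algebra.Properties.Group as Group
open import Data.Bool using (Bool; true; false; T; if_then_else_; _∧_; _∨_; not)
open import Data.Bool.ListAction using (all; any)
open import Data.Bool.Properties using (T?; T-≡; T-∧; T-∨)
open import Data.Empty using (⊥; ⊥-elim)
open import Data.Integer as ℤ using (ℤ; +_; -[1+_]; ∣_∣)
open import Data.Integer.DivMod using (_%ℕ_; _/ℕ_; n%ℕd<d; a≡a%ℕn+[a/ℕn]*n)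
import Data.Integer.Properties as ℤ
open import Data.Integer.Tactic.RingSolver using (solve-∀)
open import Data.List
  using (List; []; _∷_; _++_; map; length; filter; concatMap; cartesianProduct; deduplicate; applyUpTo; upTo)
import Data.List.Membership.DecPropositional as DecMembership
open import Data.List.Membership.Propositional using (_∈_)
open import Data.List.Membership.Propositional.Properties
  using (∈-map⁺; ∈-map⁻; ∈-++⁺ˡ; ∈-++⁺ʳ; ∈-++⁻; ∈-∃++; ∈-filter⁺; ∈-filter⁻; ∈-upTo⁺; ∈-upTo⁻;
         ∈-cartesianProduct⁺; ∈-cartesianProduct⁻)
open import Data.List.Properties using (filter-notAll; length-map; length-upTo; length-++; map-upTo)
open import Data.List.Relation.Binary.Subset.Propositional using (_⊆_)
open import Data.List.Relation.Unary.All as All using (All; []; _∷_)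
import Data.List.Relation.Unary.All.Properties as All
open import Data.List.Relation.Unary.AllPairs using ([]; _∷_)
open import Data.List.Relation.Unary.Any using (here; there)
open import Data.List.Relation.Unary.Unique.Propositional using (Unique)
import Data.List.Relation.Unary.Unique.Propositional.Properties as Unique
open import Data.Nat
  using (ℕ; zero; suc; _+_; _*_; _/_; _%_; _≤_; _<_; _≤ᵇ_; _≡ᵇ_; z≤n; s≤s; NonZero)
open import Data.Nat.DivMod using (m%n<n; m<n⇒m%n≡m; [m+kn]%n≡m%n; [m+n]%n≡m%n; m≡m%n+[m/n]*n)
open import Data.Nat.Properties hiding (_≟_)
import Data.Nat.Tactic.RingSolver as ℕ
open import Data.Product using (_×_; _,_; proj₁; proj₂; ∃-syntax)
open import Data.Product.Properties using (≡-dec)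
open import Data.Sum using (_⊎_; inj₁; inj₂)
open import Data.Unit using (tt)
open import Function using (_∘_)
open import Function.Bundles using (Equivalence)
open import Relation.Binary.Definitions using (DecidableEquality)
open import Relation.Binary.PropositionalEquality
open import Relation.Nullary using (¬_; Dec; yes; no)
open import Relation.Nullary.Decidable using (¬?; isYes; toWitness; fromWitness)

module ℤ+ = Group (AbelianGroup.group ℤ.+-0-abelianGroup)

-- Finite sums over lists.

∑ : {A : Set} → List A → (A → ℕ) → ℕ
∑ []       f = 0
∑ (x ∷ xs) f = f x + ∑ xs f

∑-mono : {A : Set} {f g : A → ℕ} → (∀ x → f x ≤ g x) → ∀ xs → ∑ xs f ≤ ∑ xs g
∑-mono f≤g []       = z≤n
∑-mono f≤g (x ∷ xs) = +-mono-≤ (f≤g x) (∑-mono f≤g xs)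

∑-cong : {A : Set} {f g : A → ℕ} → (∀ x → f x ≡ g x) → ∀ xs → ∑ xs f ≡ ∑ xs g
∑-cong f≡g []       = refl
∑-cong f≡g (x ∷ xs) = cong₂ _+_ (f≡g x) (∑-cong f≡g xs)

∑-map : {A B : Set} (g : A → B) (f : B → ℕ) → ∀ xs → ∑ (map g xs) f ≡ ∑ xs (f ∘ g)
∑-map g f []       = refl
∑-map g f (x ∷ xs) = cong₂ _+_ refl (∑-map g f xs)

∑-++ : {A : Set} (f : A → ℕ) → ∀ xs ys → ∑ (xs ++ ys) f ≡ ∑ xs f + ∑ ys f
∑-++ f []       ys = refl
∑-++ f (x ∷ xs) ys = trans (cong₂ _+_ refl (∑-++ f xs ys)) (sym (+-assoc (f x) _ _))

∑-concatMap : {A B : Set} (g : A → List B) (f : B → ℕ) → ∀ xs → ∑ (concatMap g xs) f ≡ ∑ xs (λ x → ∑ (g x) f)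
∑-concatMap g f []       = refl
∑-concatMap g f (x ∷ xs) =
  trans (∑-++ f (g x) (concatMap g xs)) (cong₂ _+_ refl (∑-concatMap g f xs))

∑-+ : {A : Set} (f g : A → ℕ) → ∀ xs → ∑ xs (λ x → f x + g x) ≡ ∑ xs f + ∑ xs g
∑-+ f g []       = refl
∑-+ f g (x ∷ xs) = trans (cong₂ _+_ refl (∑-+ f g xs)) (interchange (f x) (g x) _ _)
  where
  interchange : ∀ a b c d → a + b + (c + d) ≡ a + c + (b + d)
  interchange = ℕ.solve-∀

∑-const : {A : Set} (c : ℕ) (xs : List A) → ∑ xs (λ _ → c) ≡ c * length xs
∑-const c []       = sym (*-zeroʳ c)
∑-const c (x ∷ xs) = trans (cong₂ _+_ refl (∑-const c xs)) (sym (*-suc c (length xs)))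

∑-swap : {A B : Set} (f : A → B → ℕ) → ∀ xs ys → ∑ xs (λ x → ∑ ys (f x)) ≡ ∑ ys (λ y → ∑ xs (λ x → f x y))
∑-swap f []       ys = sym (∑-const 0 ys)
∑-swap f (x ∷ xs) ys = trans (cong₂ _+_ refl (∑-swap f xs ys)) (sym (∑-+ (f x) _ ys))

∑-filter : {A : Set} {P : A → Set} (P? : ∀ x → Dec (P x)) (f : A → ℕ) →
           ∀ xs → ∑ xs f ≡ ∑ (filter P? xs) f + ∑ (filter (¬? ∘ P?) xs) f
∑-filter P? f [] = refl
∑-filter P? f (x ∷ xs) with P? x
... | yes _ = trans (cong₂ _+_ refl (∑-filter P? f xs)) (sym (+-assoc (f x) _ _))
... | no  _ = trans (cong₂ _+_ refl (∑-filter P? f xs)) (rotate (f x) (∑ (filter P? xs) f) (∑ (filter (¬? ∘ P?) xs) f))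
  where
  rotate : ∀ a b c → a + (b + c) ≡ b + (a + c)
  rotate = ℕ.solve-∀

-- Each entry of `xs` is matched with one occurrence in `ys`. As it does not recur in `xs`, deleting
-- that occurrence keeps the remaining entries inside.
∑-⊆ : {A : Set} (f : A → ℕ) {xs ys : List A} → Unique xs → xs ⊆ ys → ∑ xs f ≤ ∑ ys f
∑-⊆ f {[]}     _            _     = z≤n
∑-⊆ f {x ∷ xs} (x∉xs ∷ xs!) xs⊆ys with ∈-∃++ (xs⊆ys (here refl))
... | as , bs , refl = begin
  f x + ∑ xs f            ≤⟨ +-monoʳ-≤ (f x) (∑-⊆ f xs! rest) ⟩
  f x + ∑ (as ++ bs) f    ≡⟨ cong₂ _+_ refl (∑-++ f as bs) ⟩
  f x + (∑ as f + ∑ bs f) ≡⟨ rotate (f x) (∑ as f) (∑ bs f) ⟩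
  ∑ as f + (f x + ∑ bs f) ≡⟨ ∑-++ f as (x ∷ bs) ⟨
  ∑ (as ++ x ∷ bs) f      ∎
  where
  open ≤-Reasoning
  rotate : ∀ a b c → a + (b + c) ≡ b + (a + c)
  rotate = ℕ.solve-∀
  rest : xs ⊆ as ++ bs
  rest {y} y∈xs with ∈-++⁻ as (xs⊆ys (there y∈xs))
  ... | inj₁ y∈as           = ∈-++⁺ˡ y∈as
  ... | inj₂ (here refl)    = ⊥-elim (All.lookup x∉xs y∈xs refl)
  ... | inj₂ (there y∈bs)   = ∈-++⁺ʳ as y∈bs

length-⊆ : {A : Set} {xs ys : List A} → Unique xs → xs ⊆ ys → length xs ≤ length ys
length-⊆ {xs = xs} {ys} xs! xs⊆ys =
  subst₂ _≤_ (count xs) (count ys) (∑-⊆ (λ _ → 1) xs! xs⊆ys)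
  where
  count : ∀ zs → ∑ zs (λ _ → 1) ≡ length zs
  count zs = trans (∑-const 1 zs) (*-identityˡ _)

∑-* : {A : Set} (c : ℕ) (f : A → ℕ) → ∀ xs → ∑ xs (λ x → c * f x) ≡ c * ∑ xs f
∑-* c f []       = sym (*-zeroʳ c)
∑-* c f (x ∷ xs) = trans (cong₂ _+_ refl (∑-* c f xs)) (sym (*-distribˡ-+ c (f x) (∑ xs f)))

∑-applyUpTo-+ : ∀ (g f : ℕ → ℕ) m n →
  ∑ (applyUpTo g (m + n)) f ≡ ∑ (applyUpTo g m) f + ∑ (applyUpTo (λ i → g (m + i)) n) f
∑-applyUpTo-+ g f zero    n = refl
∑-applyUpTo-+ g f (suc m) n =
  trans (cong₂ _+_ refl (∑-applyUpTo-+ (g ∘ suc) f m n)) (sym (+-assoc (f (g zero)) _ _))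

-- Pixels, boxes and paths

infixl 6 _⊕_

_⊕_ : Pixel → Pixel → Pixel
(x₁ , x₂) ⊕ (y₁ , y₂) = x₁ ℤ.+ y₁ , x₂ ℤ.+ y₂

origin : Pixel
origin = + 0 , + 0

directions : List Pixel
directions = (+ 1 , + 0) ∷ (-[1+ 0 ] , + 0) ∷ (+ 0 , + 1) ∷ (+ 0 , -[1+ 0 ]) ∷ []

neighbours : Pixel → List Pixel
neighbours p = map (p ⊕_) directions

_≟_ : DecidableEquality Pixel
_≟_ = ≡-dec ℤ._≟_ ℤ._≟_

open DecMembership _≟_ using (_∈?_)

⊕-assoc : ∀ p q r → (p ⊕ q) ⊕ r ≡ p ⊕ (q ⊕ r)
⊕-assoc (a , b) (c , d) (e , f) = cong₂ _,_ (ℤ.+-assoc a c e) (ℤ.+-assoc b d f)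

⊕-cancelˡ : ∀ p {q r} → p ⊕ q ≡ p ⊕ r → q ≡ r
⊕-cancelˡ (a , b) e = cong₂ _,_ (ℤ+.∙-cancelˡ a _ _ (cong proj₁ e)) (ℤ+.∙-cancelˡ b _ _ (cong proj₂ e))

⊕-cancelʳ : ∀ r {p q} → p ⊕ r ≡ q ⊕ r → p ≡ q
⊕-cancelʳ (a , b) e = cong₂ _,_ (ℤ+.∙-cancelʳ a _ _ (cong proj₁ e)) (ℤ+.∙-cancelʳ b _ _ (cong proj₂ e))

⊕-identityʳ : ∀ p → p ⊕ origin ≡ p
⊕-identityʳ (a , b) = cong₂ _,_ (ℤ.+-identityʳ a) (ℤ.+-identityʳ b)

-- Plain Boolean tests keep the search cheap to run by reduction; the `if` in `_≡ᵖ_` and `_∈ᵇ_`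
-- skips the remaining comparisons.
_≡ᶻ_ : ℤ → ℤ → Bool
(+ m)    ≡ᶻ (+ n)    = m ≡ᵇ n
-[1+ m ] ≡ᶻ -[1+ n ] = m ≡ᵇ n
_        ≡ᶻ _        = false

_≡ᵖ_ : Pixel → Pixel → Bool
(a , b) ≡ᵖ (c , d) = if a ≡ᶻ c then b ≡ᶻ d else false

_∈ᵇ_ : Pixel → List Pixel → Bool
p ∈ᵇ []       = false
p ∈ᵇ (q ∷ qs) = if p ≡ᵖ q then true else p ∈ᵇ qs

≡ᶻ-sound : ∀ i j → T (i ≡ᶻ j) → i ≡ j
≡ᶻ-sound (+ m)    (+ n)    t = cong +_ (≡ᵇ⇒≡ m n t)
≡ᶻ-sound -[1+ m ] -[1+ n ] t = cong -[1+_] (≡ᵇ⇒≡ m n t)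

≡ᶻ-refl : ∀ i → T (i ≡ᶻ i)
≡ᶻ-refl (+ n)    = ≡⇒≡ᵇ n n refl
≡ᶻ-refl -[1+ n ] = ≡⇒≡ᵇ n n refl

≡ᵖ-sound : ∀ p q → T (p ≡ᵖ q) → p ≡ q
≡ᵖ-sound (a , b) (c , d) t with a ≡ᶻ c in eq
... | true = cong₂ _,_ (≡ᶻ-sound a c (subst T (sym eq) tt)) (≡ᶻ-sound b d t)

≡ᵖ-refl : ∀ p → T (p ≡ᵖ p)
≡ᵖ-refl (a , b) with a ≡ᶻ a | ≡ᶻ-refl a
... | true | _ = ≡ᶻ-refl b

∈ᵇ⇒∈ : ∀ p qs → T (p ∈ᵇ qs) → p ∈ qs
∈ᵇ⇒∈ p (q ∷ qs) t with p ≡ᵖ q in eq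
... | true  = here (≡ᵖ-sound p q (subst T (sym eq) tt))
... | false = there (∈ᵇ⇒∈ p qs t)

∈⇒∈ᵇ : ∀ {p qs} → p ∈ qs → T (p ∈ᵇ qs)
∈⇒∈ᵇ {p} (here refl) with p ≡ᵖ p | ≡ᵖ-refl p
... | true | _ = tt
∈⇒∈ᵇ {p} {q ∷ qs} (there p∈qs) with p ≡ᵖ q
... | true  = tt
... | false = ∈⇒∈ᵇ p∈qs

i-[i+j]≡-j : ∀ i j → i ℤ.- (i ℤ.+ j) ≡ ℤ.- j
i-[i+j]≡-j = solve-∀

neighbours⇒Adj4 : ∀ p {q} → q ∈ neighbours p → Adj4 p q
neighbours⇒Adj4 (x , y) q∈ with ∈-map⁻ ((x , y) ⊕_) q∈
... | (d , e) , de∈ , refl rewrite i-[i+j]≡-j x d | i-[i+j]≡-j y e = unit de∈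
  where
  unit : ∀ {d e} → (d , e) ∈ directions → ∣ ℤ.- d ∣ + ∣ ℤ.- e ∣ ≡ 1
  unit (here refl)                         = refl
  unit (there (here refl))                 = refl
  unit (there (there (here refl)))         = refl
  unit (there (there (there (here refl)))) = refl

Adj4⇒neighbours : ∀ p {q} → Adj4 p q → q ∈ neighbours p
Adj4⇒neighbours (x , y) {x′ , y′} adj =
  subst (_∈ neighbours (x , y)) (cong₂ _,_ (recover x x′) (recover y y′))
    (∈-map⁺ ((x , y) ⊕_) (unit (x ℤ.- x′) (y ℤ.- y′) adj))
  where
  recover : ∀ i j → i ℤ.+ ℤ.- (i ℤ.- j) ≡ j
  recover = solve-∀
  unit : ∀ i j → ∣ i ∣ + ∣ j ∣ ≡ 1 → (ℤ.- i , ℤ.- j) ∈ directions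
  unit (+ 0)      (+ 1)      refl = there (there (there (here refl)))
  unit (+ 0)      -[1+ 0 ]   refl = there (there (here refl))
  unit (+ 1)      (+ 0)      refl = there (here refl)
  unit -[1+ 0 ]   (+ 0)      refl = here refl

range-⊕ : ∀ {m n i j} → i ∈ range m → j ∈ range n → i ℤ.+ j ∈ range (m + n)
range-⊕ {m} {n} i∈ j∈ with ∈-map⁻ _ i∈ | ∈-map⁻ _ j∈
... | a , a∈ , refl | b , b∈ , refl =
  subst (_∈ range (m + n)) shift (∈-map⁺ (λ i → (+ i) ℤ.- (+ (m + n))) (∈-upTo⁺ a+b<))
  where
  open ≤-Reasoning
  interchange : ∀ m n → m + m + (n + n) ≡ m + n + (m + n)
  interchange = ℕ.solve-∀
  a+b< : a + b < suc (m + n + (m + n))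
  a+b< = s≤s (begin
    a + b             ≤⟨ +-mono-≤ (≤-pred (∈-upTo⁻ a∈)) (≤-pred (∈-upTo⁻ b∈)) ⟩
    m + m + (n + n)   ≡⟨ interchange m n ⟩
    m + n + (m + n)   ∎)
  rearrange : ∀ a b m n → (a ℤ.+ b) ℤ.- (m ℤ.+ n) ≡ (a ℤ.- m) ℤ.+ (b ℤ.- n)
  rearrange = solve-∀
  shift : (+ (a + b)) ℤ.- (+ (m + n)) ≡ ((+ a) ℤ.- (+ m)) ℤ.+ ((+ b) ℤ.- (+ n))
  shift rewrite ℤ.pos-+ a b | ℤ.pos-+ m n = rearrange (+ a) (+ b) (+ m) (+ n)

box≡cartesianProduct : ∀ n → box n ≡ cartesianProduct (range n) (range n)
box≡cartesianProduct n = go (range n)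
  where
  go : ∀ xs → concatMap (λ x → map (λ y → (x , y)) (range n)) xs ≡ cartesianProduct xs (range n)
  go []       = refl
  go (x ∷ xs) = cong (map (x ,_) (range n) ++_) (go xs)

box-⊕ : ∀ {m n p q} → p ∈ box m → q ∈ box n → p ⊕ q ∈ box (m + n)
box-⊕ {m} {n} {p} {q} p∈ q∈
  with ∈-cartesianProduct⁻ (range m) (range m) (subst (p ∈_) (box≡cartesianProduct m) p∈)
     | ∈-cartesianProduct⁻ (range n) (range n) (subst (q ∈_) (box≡cartesianProduct n) q∈)
... | a , b | c , d = subst (p ⊕ q ∈_) (sym (box≡cartesianProduct (m + n)))
  (∈-cartesianProduct⁺ (range-⊕ {m} {n} a c) (range-⊕ {m} {n} b d))

box-unique : ∀ n → Unique (box n)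
box-unique n = subst Unique (sym (box≡cartesianProduct n)) (Unique.cartesianProduct⁺ range! range!)
  where
  range! : Unique (range n)
  range! = Unique.map⁺ (λ {i} {j} e → ℤ.+-injective (ℤ+.∙-cancelʳ (ℤ.- (+ n)) (+ i) (+ j) e)) (Unique.upTo⁺ _)

length-range : ∀ n → length (range n) ≡ side n
length-range n = trans (length-map (λ i → (+ i) ℤ.- (+ n)) (upTo (side n))) (length-upTo (side n))

length-box : ∀ n → length (box n) ≡ side n * side n
length-box n =
  trans (cong length (box≡cartesianProduct n)) (trans (go (range n)) (cong₂ _*_ (length-range n) (length-range n)))
  where
  go : ∀ xs → length (cartesianProduct xs (range n)) ≡ length xs * length (range n)
  go []       = refl
  go (x ∷ xs) = trans (length-++ (map (x ,_) (range n))) (cong₂ _+_ (length-map _ (range n)) (go xs))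

bit : Bool → ℕ
bit b = if b then 1 else 0

length-filter : ∀ (I : Image) xs → length (filter (λ p → T? (I p)) xs) ≡ ∑ xs (bit ∘ I)
length-filter I [] = refl
length-filter I (x ∷ xs) with I x
... | true  = cong suc (length-filter I xs)
... | false = length-filter I xs

Wcount-∑ : ∀ I n → Wcount I n ≡ ∑ (box n) (bit ∘ I)
Wcount-∑ I n = length-filter I (box n)

-- Discharging rules

Literal : Set
Literal = Pixel × Bool

-- A forest in first-child/next-sibling form: when l w c d pays w and the charge c if l holds,
-- and pays d in any case.
data Charge : Set where
  ε    : Charge
  when : Literal → ℕ → (inner next : Charge) → Charge

literal : Image → Literal → Bool
literal I (p , true)  = I p
literal I (p , false) = not (I p)

evaluate : (Literal → Bool) → Charge → ℕ
evaluate e ε              = 0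
evaluate e (when l w c d) = (if e l then w + evaluate e c else 0) + evaluate e d

translate : Pixel → Charge → Charge
translate p ε                    = ε
translate p (when (o , b) w c d) = when (p ⊕ o , b) w (translate p c) (translate p d)

-- The displacement leads from the receiver to the payer, and the charge is stated with the
-- payer at the origin.
Rule : Set
Rule = Pixel × Charge

sent : List Rule → Pixel → List Charge
sent rs p = map (λ (_ , c) → translate p c) rs

received : List Rule → Pixel → List Charge
received rs p = map (λ (d , c) → translate (p ⊕ d) c) rs

diagonals : List Pixel
diagonals = (+ 1 , + 1) ∷ (+ 1 , -[1+ 0 ]) ∷ (-[1+ 0 ] , + 1) ∷ (-[1+ 0 ] , -[1+ 0 ]) ∷ []

-- A black pixel at the origin pays its white neighbour v: 2h through the side towards v, and for
-- both directions u ⟂ v with a black pixel at u, the share of the pixel at v in the 2h belonging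
-- to u, which is h, or all of it if the opposite pixel - v is black.
blackRule : ℕ → Pixel → Rule
blackRule h (x , y) =
  v⁻ , when (origin , false) 0 (when ((x , y) , true) (2 * h) (turn u (turn u⁻ ε)) ε) ε
  where
  v⁻ u u⁻ : Pixel
  v⁻ = ℤ.- x , ℤ.- y
  u  = y , x
  u⁻ = ℤ.- y , ℤ.- x
  turn : Pixel → Charge → Charge
  turn p = when (p , false) h (when (v⁻ , false) h ε ε)

chain : ℕ → List Literal → Charge
chain w []       = ε
chain w (l ∷ []) = when l w ε ε
chain w (l ∷ ls) = when l 0 (chain w ls) ε

-- The deficit of both exceptional components is 4 in the units of blackRule. The four white
-- pixels make the two black-black edges at the outer corner have white pixels on both sides.
whiteRule : Pixel → Rule
whiteRule (x , y) =
  (x , y) , chain 4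
    ((origin , true) ∷ ((ℤ.- x , + 0) , false) ∷ ((+ 0 , ℤ.- y) , false) ∷
     ((x , ℤ.- y) , true) ∷ ((x , ℤ.- y ℤ.- y) , true) ∷
     ((ℤ.- x , y) , true) ∷ ((ℤ.- x ℤ.- x , y) , true) ∷ [])

rules : ℕ → List Rule
rules h = map (blackRule h) directions ++ map whiteRule diagonals

local-rules : ∀ h → All (λ r → proj₁ r ∈ box 1) (rules h)
-- The displacements do not depend on `h`, so the decision reduces for variable `h`.
local-rules h = toWitness {a? = All.all? (λ r → proj₁ r ∈? box 1) (rules h)} tt

-- Search over component shapes and their surroundings.

record Knowledge : Set where
  constructor _and_
  field
    whites blacks : List Pixel

-- Charges are monotone in their literals, so known gives a lower and possible an upper bound.
known possible : Knowledge → Literal → Bool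
known (ws and bs) (p , true)  = p ∈ᵇ ws
known (ws and bs) (p , false) = p ∈ᵇ bs
possible (ws and bs) (p , true)  = not (p ∈ᵇ bs)
possible (ws and bs) (p , false) = not (p ∈ᵇ ws)

settled : Knowledge → (cs ds : List Charge) → Bool
settled κ cs ds = ∑ cs (evaluate (possible κ)) ≤ᵇ ∑ ds (evaluate (known κ))

-- Splits on the colour of one pixel at a time, stopping as soon as the pessimistic comparison
-- succeeds. Any list of pixels is sound; its choice only affects whether the test succeeds.
decide : Knowledge → (cs ds : List Charge) → List Pixel → Bool
decide κ cs ds [] = settled κ cs ds
decide κ@(ws and bs) cs ds (p ∷ ps) =
  settled κ cs ds ∨
  (decide (ws and (p ∷ bs)) cs ds ps ∧ decide ((p ∷ ws) and bs) cs ds ps)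

-- Pixels on which to branch: if black, they make some undecided charge be paid.
hints : Knowledge → Charge → List Pixel
hints κ ε = []
hints κ (when l w c d) =
  (if known κ l then hints κ c else if possible κ l then proj₁ l ∷ [] else []) ++ hints κ d

-- A fixed amount written as a charge, so that it can enter a comparison of charges. It hangs on the
-- colour of the origin, which is known wherever it is used.
constant : Bool → ℕ → Charge
constant b w = when (origin , b) w ε ε

balanced : List Rule → ℕ → (ws bs : List Pixel) → Bool
balanced rs α ws bs =
  decide (ws and bs) (constant true (α * length ws) ∷ concatMap (sent rs) ws) ds
    (concatMap (hints (ws and bs)) ds)
  where ds = concatMap (received rs) ws

explore : ℕ → List Rule → ℕ → ℕ → (ws bs todo : List Pixel) → Bool
explore k rs α zero    ws bs todo     = false
explore k rs α (suc n) ws bs []       = balanced rs α ws bs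
explore k rs α (suc n) ws bs (t ∷ ts) =
  if t ∈ᵇ ws then explore k rs α n ws bs ts else
  if t ∈ᵇ bs then explore k rs α n ws bs ts else
  (explore k rs α n ws (t ∷ bs) ts ∧
   ((k ≤ᵇ length ws) ∨ explore k rs α n (t ∷ ws) bs (neighbours t ++ ts)))

-- Soundness of the search.

Black : Image → Pixel → Set
Black I p = T (not (I p))

Consistent : Image → Knowledge → Set
Consistent I (ws and bs) = All (White I) ws × All (Black I) bs

¬White×Black : ∀ I p → White I p → Black I p → ⊥
¬White×Black I p with I p
... | true = λ _ ()

White⊎Black : ∀ I p → White I p ⊎ Black I p
White⊎Black I p with I p
... | true  = inj₁ tt
... | false = inj₂ tt

known-sound : ∀ {I κ} → Consistent I κ → ∀ l → T (known κ l) → T (literal I l)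
known-sound (w , b) (p , true)  t = All.lookup w (∈ᵇ⇒∈ p _ t)
known-sound (w , b) (p , false) t = All.lookup b (∈ᵇ⇒∈ p _ t)

possible-complete : ∀ {I κ} → Consistent I κ → ∀ l → T (literal I l) → T (possible κ l)
possible-complete {I} {ws and bs} (w , b) (p , true)  t with p ∈ᵇ bs in eq
... | true  = ⊥-elim (¬White×Black I p t (All.lookup b (∈ᵇ⇒∈ p bs (subst T (sym eq) tt))))
... | false = tt
possible-complete {I} {ws and bs} (w , b) (p , false) t with p ∈ᵇ ws in eq
... | true  = ⊥-elim (¬White×Black I p (All.lookup w (∈ᵇ⇒∈ p ws (subst T (sym eq) tt))) t)
... | false = tt

-- Charges contain no negation: being black is a literal of its own, so making more literals true
-- can only add payments.
evaluate-mono : ∀ {e e′} → (∀ l → T (e l) → T (e′ l)) → ∀ c → evaluate e c ≤ evaluate e′ c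
evaluate-mono e⇒e′ ε = z≤n
evaluate-mono {e} {e′} e⇒e′ (when l w c d) with e l | e′ l | e⇒e′ l
... | true  | true  | _ = +-mono-≤ (+-monoʳ-≤ w (evaluate-mono e⇒e′ c)) (evaluate-mono e⇒e′ d)
... | true  | false | f = ⊥-elim (f tt)
... | false | _     | _ = ≤-trans (evaluate-mono e⇒e′ d) (m≤n+m _ _)

settled-sound : ∀ {I κ} → Consistent I κ → ∀ cs ds → T (settled κ cs ds) →
                ∑ cs (evaluate (literal I)) ≤ ∑ ds (evaluate (literal I))
settled-sound {I} {κ} con cs ds t = begin
  ∑ cs (evaluate (literal I))   ≤⟨ ∑-mono (evaluate-mono (possible-complete con)) cs ⟩
  ∑ cs (evaluate (possible κ)) ≤⟨ ≤ᵇ⇒≤ _ _ t ⟩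
  ∑ ds (evaluate (known κ))     ≤⟨ ∑-mono (evaluate-mono (known-sound con)) ds ⟩
  ∑ ds (evaluate (literal I))   ∎
  where open ≤-Reasoning

decide-sound : ∀ {I κ} → Consistent I κ → ∀ cs ds ps → T (decide κ cs ds ps) →
               ∑ cs (evaluate (literal I)) ≤ ∑ ds (evaluate (literal I))
decide-sound con cs ds [] t = settled-sound con cs ds t
decide-sound {I} {κ} con@(w , b) cs ds (p ∷ ps) t
  with Equivalence.to (T-∨ {settled κ cs ds}) t
... | inj₁ s = settled-sound con cs ds s
... | inj₂ s with Equivalence.to T-∧ s | White⊎Black I p
...   | _ , s₁ | inj₁ white = decide-sound (white ∷ w , b) cs ds ps s₁
...   | s₀ , _ | inj₂ black = decide-sound (w , black ∷ b) cs ds ps s₀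

outflow inflow : List Rule → Image → Pixel → ℕ
outflow rs I p = ∑ (sent rs p) (evaluate (literal I))
inflow  rs I p = ∑ (received rs p) (evaluate (literal I))

Closed : Image → List Pixel → Set
Closed I xs = ∀ p q → p ∈ xs → q ∈ neighbours p → White I q → q ∈ xs

-- The balance holds over a whole component, not pixel by pixel. What its pixels pay by the white
-- rules counts as part of their need.
record Component (rs : List Rule) (α : ℕ) (I : Image) (p : Pixel) : Set where
  field
    members   : List Pixel
    unique    : Unique members
    contains  : p ∈ members
    connected : All (WPath I p) members
    closed    : Closed I members
    supplied  : ∑ members (λ q → α + outflow rs I q) ≤ ∑ members (inflow rs I)

white-source : ∀ {I p q} → WPath I p q → White I p
white-source (here w)     = w
white-source (step w _ _) = w

white-target : ∀ {I p q} → WPath I p q → White I q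
white-target (here w)     = w
white-target (step _ _ π) = white-target π

snoc : ∀ {I p q r} → WPath I p q → Adj4 q r → White I r → WPath I p r
snoc (here w)     a v = step w a (here v)
snoc (step w b π) a v = step w b (snoc π a v)

balanced-sound : ∀ {I rs α ws bs} → Consistent I (ws and bs) → origin ∈ ws → T (balanced rs α ws bs) →
                 ∑ ws (λ p → α + outflow rs I p) ≤ ∑ ws (inflow rs I)
balanced-sound {I} {rs} {α} {ws} {bs} con@(w , _) 0∈ws t = begin
  ∑ ws (λ p → α + outflow rs I p)                      ≡⟨ ∑-+ (λ _ → α) (outflow rs I) ws ⟩
  ∑ ws (λ _ → α) + ∑ ws (outflow rs I)                 ≡⟨ cong₂ _+_ (trans (∑-const α ws) need) (sym (∑-concatMap (sent rs) e ws)) ⟩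
  e (constant true (α * length ws)) + ∑ (concatMap (sent rs) ws) e ≤⟨ decide-sound con cs ds (concatMap (hints (ws and bs)) ds) t ⟩
  ∑ (concatMap (received rs) ws) e                     ≡⟨ ∑-concatMap (received rs) e ws ⟩
  ∑ ws (inflow rs I)                                   ∎
  where
  open ≤-Reasoning
  e : Charge → ℕ
  e = evaluate (literal I)
  cs ds : List Charge
  cs = constant true (α * length ws) ∷ concatMap (sent rs) ws
  ds = concatMap (received rs) ws
  need : α * length ws ≡ e (constant true (α * length ws))
  -- The origin is white, so the constant is paid in full.
  need with I origin | All.lookup w 0∈ws
  ... | true | _ = sym (trans (+-identityʳ _) (+-identityʳ _))

explore-sound :
  ∀ {k rs α I} → ComponentsAtMost k I → ∀ n {ws bs todo} →
  origin ∈ ws → Unique ws → All (WPath I origin) ws → All (Black I) bs →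
  All (λ p → White I p → WPath I origin p) todo →
  (∀ {p q} → p ∈ ws → q ∈ neighbours p → q ∈ todo ⊎ q ∈ ws ⊎ q ∈ bs) →
  T (explore k rs α n ws bs todo) → Component rs α I origin
explore-sound {I = I} small (suc n) {ws} {bs} {[]} 0∈ws ws! paths blacks _ closed t = record
  { members   = ws
  ; unique    = ws!
  ; contains  = 0∈ws
  ; connected = paths
  ; closed    = λ p q p∈ws q∈ q-white → complete q-white (closed p∈ws q∈)
  ; supplied  = balanced-sound (All.map white-target paths , blacks) 0∈ws t
  }
  where
  complete : ∀ {q} → White I q → q ∈ [] ⊎ q ∈ ws ⊎ q ∈ bs → q ∈ ws
  complete _ (inj₂ (inj₁ q∈ws)) = q∈ws
  complete w (inj₂ (inj₂ q∈bs)) = ⊥-elim (¬White×Black I _ w (All.lookup blacks q∈bs))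
explore-sound {k} {I = I} small (suc n) {ws} {bs} {p ∷ todo} 0∈ws ws! paths blacks (path ∷ pathsₜ) closed t
  with p ∈ᵇ ws in p∈ᵇws
... | true = explore-sound small n 0∈ws ws! paths blacks pathsₜ (λ q∈ r∈ → shift (closed q∈ r∈)) t
  where
  shift : ∀ {r} → r ∈ p ∷ todo ⊎ r ∈ ws ⊎ r ∈ bs → r ∈ todo ⊎ r ∈ ws ⊎ r ∈ bs
  shift (inj₁ (here refl)) = inj₂ (inj₁ (∈ᵇ⇒∈ p ws (subst T (sym p∈ᵇws) tt)))
  shift (inj₁ (there r∈))  = inj₁ r∈
  shift (inj₂ r∈)          = inj₂ r∈
... | false with p ∈ᵇ bs in p∈ᵇbs
...   | true = explore-sound small n 0∈ws ws! paths blacks pathsₜ (λ q∈ r∈ → shift (closed q∈ r∈)) t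
  where
  shift : ∀ {r} → r ∈ p ∷ todo ⊎ r ∈ ws ⊎ r ∈ bs → r ∈ todo ⊎ r ∈ ws ⊎ r ∈ bs
  shift (inj₁ (here refl)) = inj₂ (inj₂ (∈ᵇ⇒∈ p bs (subst T (sym p∈ᵇbs) tt)))
  shift (inj₁ (there r∈))  = inj₁ r∈
  shift (inj₂ r∈)          = inj₂ r∈
...   | false with Equivalence.to T-∧ t | White⊎Black I p
...     | t₀ , _ | inj₂ black =
  explore-sound small n 0∈ws ws! paths (black ∷ blacks) pathsₜ (λ q∈ r∈ → shift (closed q∈ r∈)) t₀
  where
  shift : ∀ {r} → r ∈ p ∷ todo ⊎ r ∈ ws ⊎ r ∈ bs → r ∈ todo ⊎ r ∈ ws ⊎ r ∈ p ∷ bs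
  shift (inj₁ (here refl)) = inj₂ (inj₂ (here refl))
  shift (inj₁ (there r∈))  = inj₁ r∈
  shift (inj₂ (inj₁ r∈))   = inj₂ (inj₁ r∈)
  shift (inj₂ (inj₂ r∈))   = inj₂ (inj₂ (there r∈))
...     | _ , t₁ | inj₁ white with Equivalence.to (T-∨ {k ≤ᵇ length ws}) t₁
-- `ws` already has `k` pixels, and `p` would be a further one connected to the origin.
...       | inj₁ full = ⊥-elim (<⇒≱ (small origin (white-source (path white)) (p ∷ ws) p∷ws! (path white ∷ paths)) (≤ᵇ⇒≤ k _ full))
  where
  p∷ws! : Unique (p ∷ ws)
  p∷ws! = All.tabulate (λ { q∈ws refl → subst T p∈ᵇws (∈⇒∈ᵇ q∈ws) }) ∷ ws!
...       | inj₂ t₂ =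
  explore-sound small n (there 0∈ws) p∷ws! (path white ∷ paths) blacks
    (All.++⁺ (All.tabulate (λ q∈ → snoc (path white) (neighbours⇒Adj4 p q∈))) pathsₜ)
    (λ { (here refl) r∈ → inj₁ (∈-++⁺ˡ r∈) ; (there q∈) r∈ → shift (closed q∈ r∈) }) t₂
  where
  p∷ws! : Unique (p ∷ ws)
  p∷ws! = All.tabulate (λ { q∈ws refl → subst T p∈ᵇws (∈⇒∈ᵇ q∈ws) }) ∷ ws!
  shift : ∀ {r} → r ∈ p ∷ todo ⊎ r ∈ ws ⊎ r ∈ bs → r ∈ neighbours p ++ todo ⊎ r ∈ p ∷ ws ⊎ r ∈ bs
  shift (inj₁ (here refl)) = inj₂ (inj₁ (here refl))
  shift (inj₁ (there r∈))  = inj₁ (∈-++⁺ʳ (neighbours p) r∈)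
  shift (inj₂ (inj₁ r∈))   = inj₂ (inj₁ (there r∈))
  shift (inj₂ (inj₂ r∈))   = inj₂ (inj₂ r∈)

-- Translation to an arbitrary pixel.

infix 7 _at_

_at_ : Image → Pixel → Image
(I at p) q = I (p ⊕ q)

[i+j]-[i+k]≡j-k : ∀ i j k → (i ℤ.+ j) ℤ.- (i ℤ.+ k) ≡ j ℤ.- k
[i+j]-[i+k]≡j-k = solve-∀

Adj4-⊕ : ∀ p q r → Adj4 q r → Adj4 (p ⊕ q) (p ⊕ r)
Adj4-⊕ (a , b) (c , d) (e , f) adj rewrite [i+j]-[i+k]≡j-k a c e | [i+j]-[i+k]≡j-k b d f = adj

WPath-⊕ : ∀ {I} p {q r} → WPath (I at p) q r → WPath I (p ⊕ q) (p ⊕ r)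
WPath-⊕ p (here w)             = here w
WPath-⊕ p (step {q} {r} w a π) = step w (Adj4-⊕ p q r a) (WPath-⊕ p π)

ComponentsAtMost-at : ∀ {k I} p → ComponentsAtMost k I → ComponentsAtMost k (I at p)
ComponentsAtMost-at p small q w xs xs! paths =
  subst (_≤ _) (length-map (p ⊕_) xs)
    (small (p ⊕ q) w (map (p ⊕_) xs) (Unique.map⁺ (⊕-cancelˡ p) xs!)
      (All.map⁺ (All.map (WPath-⊕ p) paths)))

evaluate-translate : ∀ I p q c → evaluate (literal (I at p)) (translate q c) ≡ evaluate (literal I) (translate (p ⊕ q) c)
evaluate-translate I p q ε = refl
evaluate-translate I p q (when (o , b) w c d)
  rewrite evaluate-translate I p q c | evaluate-translate I p q d
  with b
... | true  rewrite ⊕-assoc p q o = refl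
... | false rewrite ⊕-assoc p q o = refl

outflow-at : ∀ rs I p q → outflow rs (I at p) q ≡ outflow rs I (p ⊕ q)
outflow-at rs I p q = begin
  ∑ (sent rs q) (evaluate (literal (I at p)))        ≡⟨ ∑-map _ _ rs ⟩
  ∑ rs (λ (_ , c) → evaluate (literal (I at p)) (translate q c)) ≡⟨ ∑-cong (λ (_ , c) → evaluate-translate I p q c) rs ⟩
  ∑ rs (λ (_ , c) → evaluate (literal I) (translate (p ⊕ q) c)) ≡⟨ ∑-map _ _ rs ⟨
  ∑ (sent rs (p ⊕ q)) (evaluate (literal I))         ∎
  where open ≡-Reasoning

inflow-at : ∀ rs I p q → inflow rs (I at p) q ≡ inflow rs I (p ⊕ q)
inflow-at rs I p q = begin
  ∑ (received rs q) (evaluate (literal (I at p)))    ≡⟨ ∑-map _ _ rs ⟩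
  ∑ rs (λ (d , c) → evaluate (literal (I at p)) (translate (q ⊕ d) c))
    ≡⟨ ∑-cong (λ (d , c) → trans (evaluate-translate I p (q ⊕ d) c)
         (cong (λ r → evaluate (literal I) (translate r c)) (sym (⊕-assoc p q d)))) rs ⟩
  ∑ rs (λ (d , c) → evaluate (literal I) (translate ((p ⊕ q) ⊕ d) c)) ≡⟨ ∑-map _ _ rs ⟨
  ∑ (received rs (p ⊕ q)) (evaluate (literal I))     ∎
  where open ≡-Reasoning

-- The search starts at the origin only; recentring the image carries its result to every white
-- pixel.
Component-at : ∀ {rs α I p} → Component rs α (I at p) origin → Component rs α I p
Component-at {rs} {α} {I} {p} C = record
  { members   = map (p ⊕_) members
  ; unique    = Unique.map⁺ (⊕-cancelˡ p) unique
  ; contains  = subst (_∈ map (p ⊕_) members) (⊕-identityʳ p) (∈-map⁺ (p ⊕_) contains)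
  ; connected = All.map⁺ (All.map (λ {q} π → subst (λ r → WPath I r (p ⊕ q)) (⊕-identityʳ p) (WPath-⊕ p π)) connected)
  ; closed    = closed′
  ; supplied  = subst₂ _≤_
      (trans (∑-cong (λ q → cong (λ n → α + n) (outflow-at rs I p q)) members) (sym (∑-map _ _ members)))
      (trans (∑-cong (inflow-at rs I p) members) (sym (∑-map _ _ members)))
      supplied
  }
  where
  open Component C
  closed′ : Closed I (map (p ⊕_) members)
  closed′ _ _ q∈ r∈ w with ∈-map⁻ (p ⊕_) q∈
  ... | q , q∈members , refl with ∈-map⁻ ((p ⊕ q) ⊕_) r∈
  ...   | d , d∈ , refl =
    subst (_∈ map (p ⊕_) members) (sym (⊕-assoc p q d))
      (∈-map⁺ (p ⊕_) (closed q (q ⊕ d) q∈members (∈-map⁺ (q ⊕_) d∈) (subst (White I) (⊕-assoc p q d) w)))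

-- Global balance of charge.

WPath-stays : ∀ {I xs} → Closed I xs → ∀ {p q} → p ∈ xs → WPath I p q → q ∈ xs
WPath-stays closed p∈ (here _)     = p∈
WPath-stays closed p∈ (step {p} {q} _ a π) =
  WPath-stays closed (closed p q p∈ (Adj4⇒neighbours p a) (white-source π)) π

-- Remove one component at a time; n only bounds the number of removals.
∑-supplied :
  ∀ {rs α I} → (∀ p → White I p → Component rs α I p) →
  ∀ n xs → length xs ≤ n → Unique xs → All (White I) xs → Closed I xs →
  ∑ xs (λ p → α + outflow rs I p) ≤ ∑ xs (inflow rs I)
∑-supplied comp n [] _ _ _ _ = z≤n
∑-supplied {rs} {α} {I} comp (suc n) xs@(x ∷ _) xs≤ xs! whites closed = begin
  ∑ xs need                        ≡⟨ ∑-filter (_∈? members) need xs ⟩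
  -- `inside` and `members` have the same entries; one inclusion bounds the needs, the other the
  -- gains.
  ∑ inside need + ∑ outside need   ≤⟨ +-mono-≤ (∑-⊆ need inside! inside⊆) outside-supplied ⟩
  ∑ members need + ∑ outside gain  ≤⟨ +-monoˡ-≤ _ supplied ⟩
  ∑ members gain + ∑ outside gain  ≤⟨ +-monoˡ-≤ _ (∑-⊆ gain unique ⊆inside) ⟩
  ∑ inside gain + ∑ outside gain   ≡⟨ ∑-filter (_∈? members) gain xs ⟨
  ∑ xs gain                        ∎
  where
  open ≤-Reasoning
  open Component (comp x (All.lookup whites (here refl))) renaming (closed to members-closed)
  need gain : Pixel → ℕ
  need p = α + outflow rs I p
  gain   = inflow rs I
  inside outside : List Pixel
  inside  = filter (_∈? members) xs
  outside = filter (¬? ∘ (_∈? members)) xs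
  inside! : Unique inside
  inside! = Unique.filter⁺ (_∈? members) xs!
  inside⊆ : inside ⊆ members
  inside⊆ p∈ = proj₂ (∈-filter⁻ (_∈? members) {xs = xs} p∈)
  ⊆inside : members ⊆ inside
  ⊆inside p∈ = ∈-filter⁺ (_∈? members) (WPath-stays closed (here refl) (All.lookup connected p∈)) p∈
  outside-closed : Closed I outside
  outside-closed p q p∈ q∈ w with ∈-filter⁻ (¬? ∘ (_∈? members)) {xs = xs} p∈
  ... | p∈xs , p∉ = ∈-filter⁺ (¬? ∘ (_∈? members)) (closed p q p∈xs q∈ w)
    -- Adjacency is symmetric, so a neighbour `q` in the component would pull `p` into it.
    λ q∈members → p∉ (members-closed q p q∈members (Adj4⇒neighbours q (Adj4-sym p q (neighbours⇒Adj4 p q∈)))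
      (All.lookup whites p∈xs))
    where
    Adj4-sym : ∀ p q → Adj4 p q → Adj4 q p
    Adj4-sym (a , b) (c , d) adj = trans (cong₂ _+_ (ℤ.∣i-j∣≡∣j-i∣ c a) (ℤ.∣i-j∣≡∣j-i∣ d b)) adj
  outside-supplied : ∑ outside need ≤ ∑ outside gain
  outside-supplied = ∑-supplied comp n outside
    (≤-pred (≤-trans (filter-notAll (¬? ∘ (_∈? members)) xs (here (λ x∉ → x∉ contains))) xs≤))
    (Unique.filter⁺ (¬? ∘ (_∈? members)) xs!)
    (All.filter⁺ (¬? ∘ (_∈? members)) whites)
    outside-closed

-- Double counting rule by rule: a fixed displacement sends distinct receivers to distinct payers,
-- at most one step outside the box in each coordinate.
∑-inflow-≤-∑-outflow :
  ∀ {rs} I n {xs} → All (λ r → proj₁ r ∈ box 1) rs → Unique xs → xs ⊆ box n →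
  ∑ xs (inflow rs I) ≤ ∑ (box (n + 1)) (outflow rs I)
∑-inflow-≤-∑-outflow {rs} I n {xs} short xs! xs⊆ = begin
  ∑ xs (inflow rs I)                                        ≡⟨ ∑-cong (λ p → ∑-map _ e rs) xs ⟩
  ∑ xs (λ p → ∑ rs (λ r → e (translate (p ⊕ proj₁ r) (proj₂ r)))) ≡⟨ ∑-swap _ xs rs ⟩
  ∑ rs (λ r → ∑ xs (λ p → e (translate (p ⊕ proj₁ r) (proj₂ r)))) ≤⟨ ∑-local rs short ⟩
  ∑ rs (λ r → ∑ (box (n + 1)) (λ p → e (translate p (proj₂ r))))  ≡⟨ ∑-swap _ rs (box (n + 1)) ⟩
  ∑ (box (n + 1)) (λ p → ∑ rs (λ r → e (translate p (proj₂ r))))  ≡⟨ ∑-cong (λ p → ∑-map _ e rs) (box (n + 1)) ⟨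
  ∑ (box (n + 1)) (outflow rs I)                            ∎
  where
  open ≤-Reasoning
  e : Charge → ℕ
  e = evaluate (literal I)
  moved : ∀ d c → d ∈ box 1 → ∑ xs (λ p → e (translate (p ⊕ d) c)) ≤ ∑ (box (n + 1)) (λ p → e (translate p c))
  moved d c d∈ = subst (_≤ _) (∑-map (_⊕ d) (λ p → e (translate p c)) xs)
    (∑-⊆ _ (Unique.map⁺ (⊕-cancelʳ d) xs!) shifted)
    where
    shifted : map (_⊕ d) xs ⊆ box (n + 1)
    shifted q∈ with ∈-map⁻ (_⊕ d) q∈
    ... | p , p∈ , refl = box-⊕ {n} {1} (xs⊆ p∈) d∈
  ∑-local : ∀ qs → All (λ r → proj₁ r ∈ box 1) qs →
    ∑ qs (λ r → ∑ xs (λ p → e (translate (p ⊕ proj₁ r) (proj₂ r)))) ≤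
    ∑ qs (λ r → ∑ (box (n + 1)) (λ p → e (translate p (proj₂ r))))
  ∑-local []             []         = z≤n
  ∑-local ((d , c) ∷ qs) (d∈ ∷ ds∈) = +-mono-≤ (moved d c d∈) (∑-local qs ds∈)

frugal : List Rule → ℕ → Bool
frugal rs β = decide ([] and (origin ∷ [])) (sent rs origin) (constant false β ∷ []) (neighbours origin)

-- After recentring at `p`, branching on the four neighbours suffices for `rules h`: a black pixel
-- pays only by the black rules, which read nothing else.
outflow-frugal : ∀ rs β → T (frugal rs β) → ∀ I p → Black I p → outflow rs I p ≤ β
outflow-frugal rs β t I p black = begin
  outflow rs I p             ≡⟨ cong (outflow rs I) (⊕-identityʳ p) ⟨
  outflow rs I (p ⊕ origin)  ≡⟨ outflow-at rs I p origin ⟨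
  outflow rs (I at p) origin ≤⟨ decide-sound ([] , black′ ∷ []) (sent rs origin) (constant false β ∷ []) (neighbours origin) t ⟩
  evaluate (literal (I at p)) (constant false β) + 0 ≤⟨ at-most ⟩
  β                          ∎
  where
  open ≤-Reasoning
  black′ : Black (I at p) origin
  black′ = subst (Black I) (sym (⊕-identityʳ p)) black
  at-most : evaluate (literal (I at p)) (constant false β) + 0 ≤ β
  at-most with not (I (p ⊕ origin))
  ... | true  = ≤-reflexive (trans (+-identityʳ _) (trans (+-identityʳ _) (+-identityʳ β)))
  ... | false = z≤n

-- Upper bound on the density.

indicator : List Pixel → Image
indicator xs p = isYes (p ∈? xs)

-- The error (j + 2)² - j² ≤ 8 j is absorbed into ε j² once j > 8 a / ε.
densityLE : ∀ I a b .{{_ : NonZero b}} →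
            (∀ n → b * Wcount I n ≤ a * (side (n + 1) * side (n + 1))) → DensityLE I a b
densityLE I a b bound m N = n , N≤ , (begin-strict
  Wcount I n * b * M                  ≡⟨ cong (_* M) (*-comm (Wcount I n) b) ⟩
  b * Wcount I n * M                  ≤⟨ *-monoˡ-≤ M (bound n) ⟩
  a * (side (n + 1) * side (n + 1)) * M ≡⟨ expand a M n ⟩
  a * M * (j * j) + a * M * (4 * j + 4) ≤⟨ +-monoʳ-≤ (a * M * (j * j)) (*-monoʳ-≤ (a * M) 4j+4≤8j) ⟩
  a * M * (j * j) + a * M * (8 * j)   ≡⟨ cong₂ _+_ refl (reassociate (a * M) j) ⟩
  a * M * (j * j) + 8 * (a * M) * j   <⟨ +-monoʳ-< (a * M * (j * j)) (*-monoˡ-< j (s≤s 8aM≤)) ⟩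
  a * M * (j * j) + j * j             ≤⟨ +-monoʳ-≤ (a * M * (j * j)) (m≤n*m (j * j) b) ⟩
  a * M * (j * j) + b * (j * j)       ≡⟨ *-distribʳ-+ (j * j) (a * M) b ⟨
  (a * M + b) * (j * j)               ∎)
  where
  open ≤-Reasoning
  M n j : ℕ
  M = suc m
  n = N + 8 * (a * M)
  j = side n
  N≤ : N ≤ j
  N≤ = ≤-trans (m≤m+n N _) (≤-trans (m≤m+n n n) (n≤1+n _))
  8aM≤ : 8 * (a * M) ≤ n + n
  8aM≤ = ≤-trans (m≤n+m (8 * (a * M)) N) (m≤m+n n n)
  expand : ∀ a M n → a * (side (n + 1) * side (n + 1)) * M ≡ a * M * (side n * side n) + a * M * (4 * side n + 4)
  expand = expand′
    where
    expand′ : ∀ a M n → a * (suc (n + 1 + (n + 1)) * suc (n + 1 + (n + 1))) * M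
              ≡ a * M * (suc (n + n) * suc (n + n)) + a * M * (4 * suc (n + n) + 4)
    expand′ = ℕ.solve-∀
  reassociate : ∀ c j → c * (8 * j) ≡ 8 * c * j
  reassociate = ℕ.solve-∀
  4j+4≤8j : 4 * j + 4 ≤ 8 * j
  4j+4≤8j = ≤-trans (+-monoʳ-≤ (4 * j) (*-monoʳ-≤ 4 (s≤s (z≤n {n + n})))) (≤-reflexive (double j))
    where
    double : ∀ j → 4 * j + 4 * j ≡ 8 * j
    double = ℕ.solve-∀

-- Black pixels own 8 h and white pixels need 8 c, which bounds the density by h / (c + h).
Verified : (k c h : ℕ) → Set
Verified k c h =
  frugal (rules h) (8 * h) ≡ true ×
  explore k (rules h) (8 * c) (8 * k) (origin ∷ []) [] directions ≡ true

module Discharging (k c h : ℕ) (verified : Verified k c h) where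

  α β : ℕ
  α = 8 * c
  β = 8 * h

  component : ∀ {I} → ComponentsAtMost k I → ∀ p → White I p → Component (rules h) α I p
  component {I} small p w = Component-at (explore-sound (ComponentsAtMost-at p small) (8 * k)
    (here refl) ([] ∷ []) (here w′ ∷ []) []
    (All.tabulate (λ q∈ v → step w′ (neighbours⇒Adj4 origin q∈) (here v)))
    (λ { (here refl) q∈ → inj₁ q∈ }) (Equivalence.from T-≡ (proj₂ verified)))
    where
    w′ : White (I at p) origin
    w′ = subst (White I) (sym (⊕-identityʳ p)) w

  -- Each white pixel needs `α` and each black one pays at most `β`, while all payers lie in the box
  -- enlarged by a frame of width 1.
  bounded : ∀ n {xs} → Unique xs → xs ⊆ box n → ComponentsAtMost k (indicator xs) →
            (α + β) * length xs ≤ β * (side (n + 1) * side (n + 1))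
  bounded n {xs} xs! xs⊆ small = begin
    (α + β) * length xs                ≡⟨ *-distribʳ-+ (length xs) α β ⟩
    -- Payments by white pixels occur on both sides of `balance` and cancel.
    α * length xs + β * length xs      ≤⟨ +-monoˡ-≤ _ (+-cancelʳ-≤ (∑ xs out) _ _ balance) ⟩
    β * length blacks + β * length xs  ≡⟨ *-distribˡ-+ β (length blacks) (length xs) ⟨
    β * (length blacks + length xs)    ≤⟨ *-monoʳ-≤ β total ⟩
    β * (side (n + 1) * side (n + 1))  ∎
    where
    open ≤-Reasoning
    I : Image
    I = indicator xs
    out : Pixel → ℕ
    out = outflow (rules h) I
    B whites blacks : List Pixel
    B      = box (n + 1)
    whites = filter (_∈? xs) B
    blacks = filter (¬? ∘ (_∈? xs)) B
    White⇒∈ : ∀ {p} → White I p → p ∈ xs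
    White⇒∈ {p} = toWitness {a? = p ∈? xs}
    ∈⇒White : ∀ {p} → p ∈ xs → White I p
    ∈⇒White {p} = fromWitness {a? = p ∈? xs}
    xs⊆B : xs ⊆ B
    xs⊆B {p} p∈ = subst (_∈ B) (⊕-identityʳ p) (box-⊕ {n} {1} (xs⊆ p∈) (toWitness {a? = origin ∈? box 1} tt))
    total : length blacks + length xs ≤ side (n + 1) * side (n + 1)
    total = begin
      length blacks + length xs      ≤⟨ +-monoʳ-≤ (length blacks) (length-⊆ xs! (λ p∈ → ∈-filter⁺ (_∈? xs) (xs⊆B p∈) p∈)) ⟩
      length blacks + length whites  ≡⟨ +-comm (length blacks) (length whites) ⟩
      length whites + length blacks  ≡⟨ cong₂ _+_ (size whites) (size blacks) ⟨
      ∑ whites (λ _ → 1) + ∑ blacks (λ _ → 1) ≡⟨ ∑-filter (_∈? xs) (λ _ → 1) B ⟨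
      ∑ B (λ _ → 1)                  ≡⟨ trans (size B) (length-box (n + 1)) ⟩
      side (n + 1) * side (n + 1)    ∎
      where
      size : ∀ ys → ∑ ys (λ _ → 1) ≡ length ys
      size ys = trans (∑-const 1 ys) (*-identityˡ _)
    paid : ∀ ys → All (Black I) ys → ∑ ys out ≤ β * length ys
    paid ys bs = ≤-trans (go ys bs) (≤-reflexive (∑-const β ys))
      where
      go : ∀ ys → All (Black I) ys → ∑ ys out ≤ ∑ ys (λ _ → β)
      go []       []       = z≤n
      go (y ∷ ys) (b ∷ bs) = +-mono-≤ (outflow-frugal (rules h) β (Equivalence.from T-≡ (proj₁ verified)) I y b) (go ys bs)
    ∉⇒Black : ∀ {p} → ¬ p ∈ xs → Black I p
    ∉⇒Black {p} p∉ with White⊎Black I p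
    ... | inj₁ w = ⊥-elim (p∉ (White⇒∈ w))
    ... | inj₂ b = b
    balance : α * length xs + ∑ xs out ≤ β * length blacks + ∑ xs out
    balance = begin
      α * length xs + ∑ xs out          ≡⟨ cong₂ _+_ (∑-const α xs) refl ⟨
      ∑ xs (λ _ → α) + ∑ xs out         ≡⟨ ∑-+ (λ _ → α) out xs ⟨
      ∑ xs (λ p → α + out p)            ≤⟨ ∑-supplied (component small) (length xs) xs ≤-refl xs! (All.tabulate ∈⇒White) (λ _ _ _ _ w → White⇒∈ w) ⟩
      ∑ xs (inflow (rules h) I)         ≤⟨ ∑-inflow-≤-∑-outflow I n (local-rules h) xs! xs⊆ ⟩
      ∑ B out                           ≡⟨ ∑-filter (_∈? xs) out B ⟩
      ∑ whites out + ∑ blacks out       ≤⟨ +-mono-≤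
        (∑-⊆ out (Unique.filter⁺ (_∈? xs) (box-unique (n + 1))) (λ p∈ → proj₂ (∈-filter⁻ (_∈? xs) {xs = B} p∈)))
        (paid blacks (All.tabulate (λ p∈ → ∉⇒Black (proj₂ (∈-filter⁻ (¬? ∘ (_∈? xs)) {xs = B} p∈))))) ⟩
      ∑ xs out + β * length blacks      ≡⟨ +-comm (∑ xs out) _ ⟩
      β * length blacks + ∑ xs out      ∎

  -- Blackening the outside of the box only removes paths, so components stay small, and it leaves
  -- finitely many white pixels to sum over.
  Wcount-bounded : ∀ I → ComponentsAtMost k I → ∀ n →
                   (α + β) * Wcount I n ≤ β * (side (n + 1) * side (n + 1))
  Wcount-bounded I small n = bounded n (Unique.filter⁺ white? (box-unique n))
      (λ p∈ → proj₁ (∈-filter⁻ white? {xs = box n} p∈)) small′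
    where
    white? : ∀ p → Dec (White I p)
    white? p = T? (I p)
    xs : List Pixel
    xs = filter white? (box n)
    restrict : ∀ {p} → White (indicator xs) p → White I p
    restrict {p} w = proj₂ (∈-filter⁻ white? {xs = box n} (toWitness {a? = p ∈? xs} w))
    path : ∀ {p q} → WPath (indicator xs) p q → WPath I p q
    path (here w)     = here (restrict w)
    path (step w a π) = step (restrict w) a (path π)
    small′ : ComponentsAtMost k (indicator xs)
    small′ p w ys ys! paths = small p (restrict w) ys ys! (All.map path paths)

  density : ∀ I .{{_ : NonZero (c + h)}} → ComponentsAtMost k I → DensityLE I h (c + h)
  density I small = densityLE I h (c + h) λ n → *-cancelˡ-≤ 8 (begin
    8 * ((c + h) * Wcount I n)               ≡⟨ *-assoc 8 (c + h) (Wcount I n) ⟨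
    8 * (c + h) * Wcount I n                 ≡⟨ cong (_* Wcount I n) (*-distribˡ-+ 8 c h) ⟩
    (α + β) * Wcount I n                     ≤⟨ Wcount-bounded I small n ⟩
    β * (side (n + 1) * side (n + 1))        ≡⟨ *-assoc 8 h _ ⟩
    8 * (h * (side (n + 1) * side (n + 1)))  ∎)
    where open ≤-Reasoning

-- Periodic images

-- Two remainders below `n` differ by a multiple of `n`. The sign of the difference of the quotients
-- decides to which side it is moved, so that the law for natural numbers applies.
[i+qn]%ℕn≡i%ℕn : ∀ i q n .{{_ : NonZero n}} → (i ℤ.+ q ℤ.* + n) %ℕ n ≡ i %ℕ n
[i+qn]%ℕn≡i%ℕn i q n =
  unique (n%ℕd<d (i ℤ.+ q ℤ.* + n) n) (n%ℕd<d i n) ((i ℤ.+ q ℤ.* + n) /ℕ n) ((i /ℕ n) ℤ.+ q) (begin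
    + (k %ℕ n) ℤ.+ (k /ℕ n) ℤ.* + n              ≡⟨ a≡a%ℕn+[a/ℕn]*n k n ⟨
    i ℤ.+ q ℤ.* + n                              ≡⟨ cong (ℤ._+ q ℤ.* + n) (a≡a%ℕn+[a/ℕn]*n i n) ⟩
    (+ (i %ℕ n) ℤ.+ (i /ℕ n) ℤ.* + n) ℤ.+ q ℤ.* + n ≡⟨ collect (+ (i %ℕ n)) (i /ℕ n) q (+ n) ⟩
    + (i %ℕ n) ℤ.+ ((i /ℕ n) ℤ.+ q) ℤ.* + n      ∎)
  where
  open ≡-Reasoning
  k : ℤ
  k = i ℤ.+ q ℤ.* + n
  collect : ∀ r a b m → (r ℤ.+ a ℤ.* m) ℤ.+ b ℤ.* m ≡ r ℤ.+ (a ℤ.+ b) ℤ.* m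
  collect = solve-∀
  natural : ∀ {r s} → r < n → s < n → ∀ c → + r ≡ + s ℤ.+ + c ℤ.* + n → r ≡ s
  natural {r} {s} r<n s<n c e = begin
    r               ≡⟨ m<n⇒m%n≡m r<n ⟨
    r % n           ≡⟨ cong (_% n) (ℤ.+-injective (trans e (trans (cong (λ z → + s ℤ.+ z) (sym (ℤ.pos-* c n))) (sym (ℤ.pos-+ s (c * n)))))) ⟩
    (s + c * n) % n ≡⟨ [m+kn]%n≡m%n s c n ⟩
    s % n           ≡⟨ m<n⇒m%n≡m s<n ⟩
    s               ∎
  unique : ∀ {r s} → r < n → s < n → ∀ a b → + r ℤ.+ a ℤ.* + n ≡ + s ℤ.+ b ℤ.* + n → r ≡ s
  unique {r} {s} r<n s<n a b e with b ℤ.- a in b-a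
  ... | + c      = natural r<n s<n c (trans (move₁ (+ r) (+ s) a b (+ n) e) (cong (λ z → + s ℤ.+ z ℤ.* + n) b-a))
    where
    move₁ : ∀ r s a b m → r ℤ.+ a ℤ.* m ≡ s ℤ.+ b ℤ.* m → r ≡ s ℤ.+ (b ℤ.- a) ℤ.* m
    move₁ r s a b m e = trans (lhs r a m) (trans (cong (λ z → z ℤ.- a ℤ.* m) e) (rhs s a b m))
      where
      lhs : ∀ r a m → r ≡ (r ℤ.+ a ℤ.* m) ℤ.- a ℤ.* m
      lhs = solve-∀
      rhs : ∀ s a b m → (s ℤ.+ b ℤ.* m) ℤ.- a ℤ.* m ≡ s ℤ.+ (b ℤ.- a) ℤ.* m
      rhs = solve-∀
  ... | -[1+ c ] = sym (natural s<n r<n (suc c) (trans (move₂ (+ r) (+ s) a b (+ n) e) (cong (λ z → + r ℤ.+ (ℤ.- z) ℤ.* + n) b-a)))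
    where
    move₂ : ∀ r s a b m → r ℤ.+ a ℤ.* m ≡ s ℤ.+ b ℤ.* m → s ≡ r ℤ.+ (ℤ.- (b ℤ.- a)) ℤ.* m
    move₂ r s a b m e = trans (lhs s b m) (trans (cong (λ z → z ℤ.- b ℤ.* m) (sym e)) (rhs r a b m))
      where
      lhs : ∀ s b m → s ≡ (s ℤ.+ b ℤ.* m) ℤ.- b ℤ.* m
      lhs = solve-∀
      rhs : ∀ r a b m → (r ℤ.+ a ℤ.* m) ℤ.- b ℤ.* m ≡ r ℤ.+ (ℤ.- (b ℤ.- a)) ℤ.* m
      rhs = solve-∀

[i+j]%ℕn≡[i%ℕn+j]%ℕn : ∀ i j n .{{_ : NonZero n}} → (i ℤ.+ j) %ℕ n ≡ (+ (i %ℕ n) ℤ.+ j) %ℕ n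
[i+j]%ℕn≡[i%ℕn+j]%ℕn i j n = begin
  (i ℤ.+ j) %ℕ n ≡⟨ cong (λ z → (z ℤ.+ j) %ℕ n) (a≡a%ℕn+[a/ℕn]*n i n) ⟩
  ((+ (i %ℕ n) ℤ.+ (i /ℕ n) ℤ.* + n) ℤ.+ j) %ℕ n ≡⟨ cong (_%ℕ n) (swap (+ (i %ℕ n)) ((i /ℕ n) ℤ.* + n) j) ⟩
  ((+ (i %ℕ n) ℤ.+ j) ℤ.+ (i /ℕ n) ℤ.* + n) %ℕ n ≡⟨ [i+qn]%ℕn≡i%ℕn (+ (i %ℕ n) ℤ.+ j) (i /ℕ n) n ⟩
  (+ (i %ℕ n) ℤ.+ j) %ℕ n ∎
  where
  open ≡-Reasoning
  swap : ∀ a b c → (a ℤ.+ b) ℤ.+ c ≡ (a ℤ.+ c) ℤ.+ b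
  swap = solve-∀

or-not : ∀ {a b} → T a → T (not a ∨ b) → T b
or-not {true} _ t = t

module Periodic (N : ℕ) .{{_ : NonZero N}} (c : ℤ) (residues : List ℕ) where

  white : ℕ → Bool
  white r = any (r ≡ᵇ_) residues

  weight : Pixel → ℤ
  weight (x , y) = c ℤ.* x ℤ.+ y

  advance : ℕ → Pixel → ℕ
  advance r d = (+ r ℤ.+ weight d) %ℕ N

  residue : Pixel → ℕ
  residue p = weight p %ℕ N

  image : Image
  image p = white (residue p)

  residue-⊕ : ∀ p d → residue (p ⊕ d) ≡ advance (residue p) d
  residue-⊕ p@(x , y) d@(u , v) =
    trans (cong (_%ℕ N) (additive c x y u v)) ([i+j]%ℕn≡[i%ℕn+j]%ℕn (weight p) (weight d) N)
    where
    additive : ∀ c x y u v → c ℤ.* (x ℤ.+ u) ℤ.+ (y ℤ.+ v) ≡ (c ℤ.* x ℤ.+ y) ℤ.+ (c ℤ.* u ℤ.+ v)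
    additive = solve-∀

  -- Displacements reached from a white pixel of residue `r` by at most `n` white steps. They depend
  -- on the residue alone, so finitely many lists describe all components.
  reach : ℕ → ℕ → List Pixel
  reach zero    r = origin ∷ []
  reach (suc n) r = deduplicate _≟_ (origin ∷ concatMap steps directions)
    where
    steps : Pixel → List Pixel
    steps d = if white (advance r d) then map (d ⊕_) (reach n (advance r d)) else []

  enters : ℕ → ℕ → Pixel → Bool
  enters n r d = not (white (advance r d)) ∨ all (λ o → (d ⊕ o) ∈ᵇ reach n r) (reach n (advance r d))

  -- A certificate that `n` steps exhaust the component: putting one step in front of a displacement
  -- already reached gives nothing new, so by induction paths of any length stay in `reach n r`.
  settles : ℕ → ℕ → ℕ → Bool
  settles n k r = not (white r) ∨ ((length (reach n r) ≤ᵇ k) ∧ all (enters n r) directions)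

  origin∈reach : ∀ n r → origin ∈ reach n r
  origin∈reach zero    r = here refl
  origin∈reach (suc n) r = here refl

  residue< : ∀ p → residue p < N
  residue< p = n%ℕd<d (weight p) N

  module _ {n k : ℕ} (check : T (all (settles n k) (upTo N))) where

    settled-white : ∀ {p} → White image p →
      let r = residue p in
      length (reach n r) ≤ k ×
      (∀ {d o} → d ∈ directions → T (white (advance r d)) → o ∈ reach n (advance r d) → d ⊕ o ∈ reach n r)
    settled-white {p} w
      with Equivalence.to T-∧ (or-not w (All.lookup (All.all⁺ (settles n k) (upTo N) check) (∈-upTo⁺ (residue< p))))
    ... | short , inside = ≤ᵇ⇒≤ _ k short , λ {d} {o} d∈ w′ o∈ →
      ∈ᵇ⇒∈ (d ⊕ o) (reach n r)
        (All.lookup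
          (All.all⁺ (λ q → (d ⊕ q) ∈ᵇ reach n r) (reach n (advance r d))
            (or-not w′ (All.lookup (All.all⁺ (enters n r) directions inside) d∈)))
          o∈)
      where
      r : ℕ
      r = residue p

    WPath⇒reach : ∀ {p q} → WPath image p q → ∃[ o ] o ∈ reach n (residue p) × q ≡ p ⊕ o
    WPath⇒reach {p} (here _) = origin , origin∈reach n _ , sym (⊕-identityʳ p)
    WPath⇒reach {p} (step w adj π)
      with ∈-map⁻ (p ⊕_) (Adj4⇒neighbours p adj) | WPath⇒reach π
    ... | d , d∈ , refl | o , o∈ , refl =
      d ⊕ o ,
      proj₂ (settled-white w) d∈ (subst (T ∘ white) (residue-⊕ p d) (white-source π))
        (subst (λ s → o ∈ reach n s) (residue-⊕ p d) o∈) ,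
      ⊕-assoc p d o

    componentsAtMost : ComponentsAtMost k image
    componentsAtMost p w xs xs! paths = begin
      length xs                                 ≤⟨ length-⊆ xs! xs⊆ ⟩
      length (map (p ⊕_) (reach n (residue p))) ≡⟨ length-map (p ⊕_) (reach n (residue p)) ⟩
      length (reach n (residue p))              ≤⟨ proj₁ (settled-white w) ⟩
      k                                         ∎
      where
      open ≤-Reasoning
      xs⊆ : xs ⊆ map (p ⊕_) (reach n (residue p))
      xs⊆ q∈ with WPath⇒reach (All.lookup paths q∈)
      ... | o , o∈ , refl = ∈-map⁺ (p ⊕_) o∈

  -- One step in the second coordinate raises the residue by 1, so a line of `m` pixels meets `m`
  -- consecutive residues modulo `N`, starting at `s`.
  whites-from : ℕ → ℕ → ℕ
  whites-from s m = ∑ (upTo m) (λ i → bit (white ((s + i) % N)))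

  whites-from-+ : ∀ s m → whites-from s (N + m) ≡ whites-from s N + whites-from s m
  whites-from-+ s m = begin
    ∑ (upTo (N + m)) f                          ≡⟨ ∑-applyUpTo-+ (λ i → i) f N m ⟩
    ∑ (upTo N) f + ∑ (applyUpTo (λ i → N + i) m) f     ≡⟨ cong₂ _+_ refl (cong (λ xs → ∑ xs f) (map-upTo (λ i → N + i) m)) ⟨
    ∑ (upTo N) f + ∑ (map (λ i → N + i) (upTo m)) f    ≡⟨ cong₂ _+_ refl (∑-map (λ i → N + i) f (upTo m)) ⟩
    ∑ (upTo N) f + ∑ (upTo m) (λ i → f (N + i)) ≡⟨ cong₂ _+_ refl (∑-cong period (upTo m)) ⟩
    ∑ (upTo N) f + ∑ (upTo m) f                 ∎
    where
    open ≡-Reasoning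
    f : ℕ → ℕ
    f i = bit (white ((s + i) % N))
    rotate : ∀ s N i → s + (N + i) ≡ s + i + N
    rotate = ℕ.solve-∀
    period : ∀ i → f (N + i) ≡ f i
    period i = cong (bit ∘ white) (trans (cong (_% N) (rotate s N i)) ([m+n]%n≡m%n (s + i) N))

  module _ {a : ℕ} (check : T (all (λ s → a ≤ᵇ whites-from s N) (upTo N))) where

    -- Every full period contributes at least `a`; the incomplete last one is given up, which costs
    -- at most `a * N`.
    whites-from-≥ : ∀ {s} → s < N → ∀ m → a * m ≤ N * whites-from s m + a * N
    whites-from-≥ {s} s<N m = begin
      a * m                                       ≡⟨ cong (a *_) m≡ ⟩
      a * (m / N * N + m % N)                     ≤⟨ *-monoʳ-≤ a (+-monoʳ-≤ (m / N * N) (<⇒≤ (m%n<n m N))) ⟩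
      a * (m / N * N + N)                         ≡⟨ expand a (m / N) N ⟩
      N * (m / N * a) + a * N                     ≤⟨ +-monoˡ-≤ (a * N) (*-monoʳ-≤ N (periods (m / N) (m % N))) ⟩
      N * whites-from s (m / N * N + m % N) + a * N ≡⟨ cong (λ l → N * whites-from s l + a * N) m≡ ⟨
      N * whites-from s m + a * N                 ∎
      where
      open ≤-Reasoning
      m≡ : m ≡ m / N * N + m % N
      m≡ = trans (m≡m%n+[m/n]*n m N) (+-comm (m % N) _)
      expand : ∀ a q N → a * (q * N + N) ≡ N * (q * a) + a * N
      expand = ℕ.solve-∀
      periods : ∀ q r → q * a ≤ whites-from s (q * N + r)
      periods zero    r = z≤n
      periods (suc q) r = begin
        a + q * a                                 ≤⟨ +-mono-≤ (≤ᵇ⇒≤ a _ (All.lookup (All.all⁺ _ (upTo N) check) (∈-upTo⁺ s<N))) (periods q r) ⟩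
        whites-from s N + whites-from s (q * N + r) ≡⟨ whites-from-+ s (q * N + r) ⟨
        whites-from s (N + (q * N + r))           ≡⟨ cong (whites-from s) (+-assoc N (q * N) r) ⟨
        whites-from s (N + q * N + r)             ∎

    row : ∀ n x → ∑ (range n) (λ y → bit (image (x , y))) ≡ whites-from (residue (x , ℤ.- (+ n))) (side n)
    row n x = trans (∑-map (λ i → (+ i) ℤ.- (+ n)) (λ y → bit (image (x , y))) (upTo (side n)))
      (∑-cong (λ i → cong (bit ∘ white) (shifted i)) (upTo (side n)))
      where
      start : Pixel
      start = x , ℤ.- (+ n)
      position : ∀ i → (x , (+ i) ℤ.- (+ n)) ≡ start ⊕ (+ 0 , + i)
      position i = cong₂ _,_ (sym (ℤ.+-identityʳ x)) (ℤ.+-comm (+ i) (ℤ.- (+ n)))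
      shifted : ∀ i → residue (x , (+ i) ℤ.- (+ n)) ≡ (residue start + i) % N
      shifted i = trans (cong residue (position i)) (trans (residue-⊕ start (+ 0 , + i))
        (cong (_%ℕ N) (trans (cong (λ z → + residue start ℤ.+ z) (trans (cong (ℤ._+ + i) (ℤ.*-zeroʳ c)) (ℤ.+-identityˡ (+ i))))
          (sym (ℤ.pos-+ (residue start) i)))))

    -- The loss is `a * N` for each of the `side n` lines, hence linear in the side against a
    -- quadratic main term.
    Wcount-≥ : ∀ n → a * (side n * side n) ≤ N * Wcount image n + a * N * side n
    Wcount-≥ n = begin
      a * (j * j)                              ≡⟨ *-assoc a j j ⟨
      a * j * j                                ≡⟨ cong (a * j *_) (length-range n) ⟨
      a * j * length (range n)                 ≡⟨ ∑-const (a * j) (range n) ⟨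
      ∑ (range n) (λ _ → a * j)                ≤⟨ ∑-mono (λ x → whites-from-≥ (residue< (x , ℤ.- (+ n))) j) (range n) ⟩
      ∑ (range n) (λ x → N * line x + a * N)   ≡⟨ ∑-+ (λ x → N * line x) (λ _ → a * N) (range n) ⟩
      ∑ (range n) (λ x → N * line x) + ∑ (range n) (λ _ → a * N) ≡⟨ cong₂ _+_ (∑-* N line (range n)) (∑-const (a * N) (range n)) ⟩
      N * ∑ (range n) line + a * N * length (range n) ≡⟨ cong₂ (λ w l → N * w + a * N * l) total (length-range n) ⟩
      N * Wcount image n + a * N * j           ∎
      where
      open ≤-Reasoning
      j : ℕ
      j = side n
      line : ℤ → ℕ
      line x = whites-from (residue (x , ℤ.- (+ n))) j
      rows : ℤ → List Pixel
      rows x = map (x ,_) (range n)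
      total : ∑ (range n) line ≡ Wcount image n
      total = begin-equality
        ∑ (range n) line                                       ≡⟨ ∑-cong (row n) (range n) ⟨
        ∑ (range n) (λ x → ∑ (range n) (λ y → bit (image (x , y)))) ≡⟨ ∑-cong (λ x → ∑-map (x ,_) (bit ∘ image) (range n)) (range n) ⟨
        ∑ (range n) (λ x → ∑ (rows x) (bit ∘ image))           ≡⟨ ∑-concatMap rows (bit ∘ image) (range n) ⟨
        ∑ (box n) (bit ∘ image)                                ≡⟨ Wcount-∑ image n ⟨
        Wcount image n                                         ∎

    densityGE : ∀ m → DensityGE-eps image a N m
    -- The linear loss falls below the allowed quadratic error as soon as the side exceeds
    -- `a * suc m`.
    densityGE m = suc (a * suc m) , λ n aM<j → begin-strict
      a * suc m * (side n * side n)                                    ≡⟨ pull a (suc m) (side n * side n) ⟩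
      suc m * (a * (side n * side n))                                  ≤⟨ *-monoʳ-≤ (suc m) (Wcount-≥ n) ⟩
      suc m * (N * Wcount image n + a * N * side n)                    ≡⟨ expand (suc m) N (Wcount image n) a (side n) ⟩
      Wcount image n * N * suc m + N * (a * suc m * side n)            <⟨ +-monoʳ-< (Wcount image n * N * suc m) (*-monoʳ-< N (*-monoˡ-< (side n) aM<j)) ⟩
      Wcount image n * N * suc m + N * (side n * side n)               ∎
      where
      open ≤-Reasoning
      pull : ∀ a M q → a * M * q ≡ M * (a * q)
      pull = ℕ.solve-∀
      expand : ∀ M N w a j → M * (N * w + a * N * j) ≡ w * N * M + N * (a * M * j)
      expand = ℕ.solve-∀

-- The two tilings and the conclusion.

-- Neighbours differ by 1 or 5 modulo 24. The L-trominoes are 3, 4, 9; 6, 7, 11; 13, 17, 18; and 15,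
-- 20, 21, with corners 4, 6, 18 and 20; 0 is the single pixel.
module LTrominoes = Periodic 24 (+ 5) (0 ∷ 3 ∷ 4 ∷ 6 ∷ 7 ∷ 9 ∷ 11 ∷ 13 ∷ 15 ∷ 17 ∷ 18 ∷ 20 ∷ 21 ∷ [])
-- Residue 0 is the centre of a plus; its arms are 1, 7, 3 and 5, that is plus or minus 1 and 3
-- modulo 8.
module Pluses     = Periodic 8  (+ 3) (0 ∷ 1 ∷ 3 ∷ 5 ∷ 7 ∷ [])

-- Reduction runs the whole search. The numbers make `h / (c + h)` equal to 13/24 here and to 5/8
-- below.
verified-3 : Verified 3 11 13
verified-3 = refl , refl

verified-6 : Verified 6 3 5
verified-6 = refl , refl

theorem8p1 : Phi4Is 3 13 24 × Phi4Is 6 5 8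
theorem8p1 =
  ( (λ I → Discharging.density 3 11 13 verified-3 I)
  -- Two steps join any two pixels of an L-tromino, and likewise of a plus, so `reach 2` is
  -- complete; 13 of 24 residues are white here, 5 of 8 below.
  , λ m → LTrominoes.image , LTrominoes.componentsAtMost {2} tt , LTrominoes.densityGE {13} tt m ) ,
  ( (λ I → Discharging.density 6 3 5 verified-6 I)
  , λ m → Pluses.image , Pluses.componentsAtMost {2} tt , Pluses.densityGE {5} tt m )
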